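{- Let $q$ be an odd prime power and $d\ge 3$. For all $\lambda\in \mathbb{F}_q$, there exists $E\subset \mathbb{F}_q^d$ with $|E|=q$ such that for all $\mathbf{y}\in \mathbb{F}_q^{d-1}\times \{\lambda\}$ one has $|\{\mathbf{y}\cdot \mathbf x:\mathbf x\in E\}|\le \frac{q+1}{2}$; consequently $$\mathcal{T}_1 \left( X_\pi , E , \frac{q+1}{2} \right) =X_\pi.$$
   Context: $\mathbb F_q$ is the finite field with $q$ elements. For $\mathbf x\in\mathbb F_q^d$, $\|\mathbf x\|=x_1^2+\cdots+x_d^2$, and $\mathbf x\cdot\mathbf y=\sum_i x_iy_i$. $S^{d-1}=\{\mathbf x\in\mathbb F_q^d:\|\mathbf x\|=1\}$, $\pi=\{\mathbf x\in\mathbb F_q^d: x_d=\lambda\}$. $X_\pi$ is the set of lines through the origin (one-dimensional linear subspaces of $\mathbb F_q^d$) that contain a nonzero element of $\pi\cap S^{d-1}$. For a linear subspace $V$, $V^\perp=\{\mathbf x\in\mathbb F_q^d:\mathbf x\cdot\mathbf y=0\ \forall \mathbf y\in V\}$, and $\pi_V(E)=\{\mathbf x+V^\perp:\mathbf x\in\mathbb F_q^d,\ (\mathbf x+V^\perp)\cap E\neq\emptyset\}$, a set of cosets. $\mathcal T_1(X_\pi,E,N)=\{V\in X_\pi: |\pi_V(E)|\le N\}$. -}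

module Defs where

open import Algebra.Apartness.Bundles using (HeytingCommutativeRing; HeytingField)
open import Algebra.Bundles using (CommutativeRing)
import Algebra.Definitions.RawMonoid as RawMonoidDefinitions
open import Data.Fin.Base using (Fin)
open import Data.Nat.Base using (ℕ; suc; _≤_; _^_)
open import Data.Nat.Divisibility using (_∣_)
open import Data.Nat.Primality using (Prime)
open import Data.Product.Base using (∃; ∃-syntax; _×_; proj₁)
open import Data.Vec.Functional using (Vector; zipWith; map; replicate; last)
import Data.Vec.Functional.Relation.Binary.Equality.Setoid as VectorEquality
open import Function.Bundles using (Bijection)
open import Level using (Level; _⊔_) renaming (suc to lsuc)
open import Relation.Binary.Bundles using (Setoid)
open import Relation.Binary.Definitions using (_Respects_)
import Relation.Binary.Construct.On as On
import Relation.Binary.PropositionalEquality as ≡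
open import Relation.Nullary.Negation using (¬_)
open import Relation.Unary using (Pred; _∈_; _≐_)
open import Relation.Unary.Relation.Binary.Equality using (≐-setoid)

IsOddPrimePower : ℕ → Set
IsOddPrimePower q = ∃[ p ] ∃[ k ] Prime p × 1 ≤ k × q ≡.≡ p ^ k × ¬ (2 ∣ q)

-- Sizes are counted up to the equality of the ambient setoid: elements of a
-- subset are compared by their first components only.

module _ {a ℓ p : Level} (S : Setoid a ℓ) where

  subsetoid : Pred (Setoid.Carrier S) p → Setoid (a ⊔ p) ℓ
  subsetoid P = On.setoid {B = ∃ P} S proj₁

  HasSize : Pred (Setoid.Carrier S) p → ℕ → Set (a ⊔ ℓ ⊔ p)
  HasSize P n = Bijection (subsetoid P) (≡.setoid (Fin n))

  SizeAtMost : Pred (Setoid.Carrier S) p → ℕ → Set (a ⊔ ℓ ⊔ p)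
  SizeAtMost P N = ∃[ n ] n ≤ N × HasSize P n

commutativeRing : ∀ {c ℓ₁ ℓ₂} → HeytingField c ℓ₁ ℓ₂ → CommutativeRing c ℓ₁
commutativeRing F =
  HeytingCommutativeRing.commutativeRing (HeytingField.heytingCommutativeRing F)

-- In a Heyting field of finite order, tightness of the apartness relation and
-- decidability of ≈ make every element ≉ 0# invertible; conversely a finite
-- field in the ordinary sense is a Heyting field whose apartness is _≉_.

HasOrder : ∀ {c ℓ₁ ℓ₂} → HeytingField c ℓ₁ ℓ₂ → ℕ → Set (c ⊔ ℓ₁)
HasOrder F q = Bijection (CommutativeRing.setoid (commutativeRing F)) (≡.setoid (Fin q))

module FieldGeometry {c ℓ₁ ℓ₂ : Level} (F : HeytingField c ℓ₁ ℓ₂) where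

  open HeytingField F public
    using (Carrier; _≈_; _+_; _*_; 0#; 1#)
  open CommutativeRing (commutativeRing F) public using (setoid)
  open RawMonoidDefinitions (CommutativeRing.+-rawMonoid (commutativeRing F)) using (sum)
  open VectorEquality setoid public using (_≋_; ≋-setoid)

  Vector𝔽 : ℕ → Set c
  Vector𝔽 = Vector Carrier

  Subset : ℕ → Set (lsuc (c ⊔ ℓ₁))
  Subset d = Pred (Vector𝔽 d) (c ⊔ ℓ₁)

  infixl 6 _+ᵛ_
  infixr 7 _*ᵛ_
  infix  8 _·_

  0ᵛ : ∀ {d} → Vector𝔽 d
  0ᵛ = replicate _ 0#

  _+ᵛ_ : ∀ {d} → Vector𝔽 d → Vector𝔽 d → Vector𝔽 d
  _+ᵛ_ = zipWith _+_

  _*ᵛ_ : ∀ {d} → Carrier → Vector𝔽 d → Vector𝔽 d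
  a *ᵛ x = map (a *_) x

  _·_ : ∀ {d} → Vector𝔽 d → Vector𝔽 d → Carrier
  x · y = sum (zipWith _*_ x y)

  -- The paper's x₁² + ⋯ + x_d², without a square root.
  ‖_‖ : ∀ {d} → Vector𝔽 d → Carrier
  ‖ x ‖ = sum (map (λ xᵢ → xᵢ * xᵢ) x)

  Sphere : ∀ {d} → Pred (Vector𝔽 d) ℓ₁
  Sphere x = ‖ x ‖ ≈ 1#

  -- Also the set 𝔽^n × {λ₀}.
  Hyperplane : ∀ {n} → Carrier → Pred (Vector𝔽 (suc n)) ℓ₁
  Hyperplane λ₀ x = last x ≈ λ₀

  record IsLinearSubspace {d} (V : Subset d) : Set (c ⊔ ℓ₁) where
    field
      respects  : V Respects _≋_
      0-closed  : 0ᵛ ∈ V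
      +-closed  : ∀ {x y} → x ∈ V → y ∈ V → x +ᵛ y ∈ V
      *-closed  : ∀ a {x} → x ∈ V → a *ᵛ x ∈ V

  record IsLine {d} (V : Subset d) : Set (c ⊔ ℓ₁) where
    field
      isLinearSubspace : IsLinearSubspace V
      direction        : Vector𝔽 d
      direction∈V      : direction ∈ V
      direction≉0      : ¬ (direction ≋ 0ᵛ)
      spans            : ∀ {x} → x ∈ V → ∃[ a ] x ≋ a *ᵛ direction

  X-π : ∀ {n} → Carrier → Pred (Subset (suc n)) (c ⊔ ℓ₁)
  X-π λ₀ V = IsLine V ×
    ∃[ x ] x ∈ V × ¬ (x ≋ 0ᵛ) × x ∈ Hyperplane λ₀ × x ∈ Sphere

  _⊥ : ∀ {d} → Subset d → Subset d
  (V ⊥) x = ∀ y → y ∈ V → x · y ≈ 0#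

  Coset : ∀ {d} → Vector𝔽 d → Subset d → Subset d
  Coset x W z = ∃[ w ] w ∈ W × z ≋ x +ᵛ w

  -- The set π_V(E) of cosets of V ⊥ meeting E.  Its members are subsets of
  -- 𝔽^d, so they are compared, and counted, by _≐_.
  Projection : ∀ {d} → Subset d → Subset d → Pred (Subset d) (c ⊔ ℓ₁)
  Projection V E C =
    ∃[ x ] C ≐ Coset x (V ⊥) × ∃[ z ] z ∈ Coset x (V ⊥) × z ∈ E

  DotValues : ∀ {d} → Vector𝔽 d → Subset d → Pred Carrier (c ⊔ ℓ₁)
  DotValues y E a = ∃[ x ] x ∈ E × a ≈ y · x

  𝒯₁ : ∀ {d} → Pred (Subset d) (c ⊔ ℓ₁) → Subset d → ℕ →
       Pred (Subset d) (lsuc (c ⊔ ℓ₁))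
  𝒯₁ {d} X E N V =
    V ∈ X × SizeAtMost (≐-setoid (Vector𝔽 d) (c ⊔ ℓ₁)) (Projection V E) N

{-# OPTIONS --safe #-}

-- For λ₀ ≉ 0 let E be the parabola of all points (t, 0, …, 0, t²).  If y has
-- last coordinate λ₀ then y · x, as a function of t ∈ 𝔽_q, is the quadratic
-- y₁ t + λ₀ t², which is invariant under t ↦ - y₁ / λ₀ - t.  As 2 is
-- invertible this reflection has only one fixed point, so two preimages can be
-- chosen for all but at most one value and there are at most (q + 1)/2 values.
-- For λ₀ ≈ 0 the last coordinate axis works, since y · x vanishes on it.
-- Finally, for a line V through a unit vector y the cosets of V ⊥ are the level
-- sets of y ·_, so the projection π_V(E) and the values y · x correspond.

module Submission where

open import Defs
open import Algebra.Apartness.Bundles using (HeytingField)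
import Algebra.Apartness.Properties.HeytingCommutativeRing as HeytingProperties
open import Algebra.Bundles using (CommutativeRing)
import Algebra.Properties.CommutativeSemigroup as CommutativeSemigroupProperties
import Algebra.Properties.Ring as RingProperties
import Algebra.Properties.Semiring.Mult as SemiringMult
import Algebra.Properties.Semiring.Sum as SemiringSum
open import Data.Fin.Base using (Fin; zero; suc; fromℕ)
open import Data.Fin.Permutation using (Permutation; permutation; _⟨$⟩ʳ_)
import Data.Fin.Properties as Fin
open import Data.Nat.Base using (ℕ; zero; suc; _≤_; _<_; s≤s; _/_; _%_)
  renaming (_+_ to _+ℕ_; _*_ to _*ℕ_)
open import Data.Nat.Divisibility using (_∣_; divides)
open import Data.Nat.DivMod using (m≡m%n+[m/n]*n; m%n<n; m*n/n≡m; /-monoˡ-≤)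
import Data.Nat.Properties as ℕ
open import Data.Product.Base using (Σ-syntax; ∃-syntax; _×_; _,_; proj₁; proj₂)
open import Data.Sum.Base using (_⊎_; inj₁; inj₂)
open import Data.Vec.Functional using (_∷_; replicate; zipWith)
open import Function.Base using (_∘_)
open import Function.Bundles using (Bijection; Inverse; Injection)
open import Function.Definitions using (Injective)
open import Function.Properties.Bijection using (Bijection⇒Inverse)
open import Function.Properties.Inverse using (Inverse⇒Bijection)
open import Level using (Level; _⊔_)
open import Relation.Binary.Bundles using (Setoid)
open import Relation.Binary.Core using (_Preserves_⟶_)
open import Relation.Binary.Definitions using (_Respects_; Decidable)
import Relation.Binary.PropositionalEquality as ≡
open ≡ using (_≡_)
import Relation.Binary.Reasoning.Setoid as SetoidReasoning
open import Relation.Nullary.Decidable using (Dec; yes; no)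
open import Relation.Nullary.Negation using (¬_; contradiction)
open import Relation.Unary using (Pred; _∈_; _≐_)
open import Relation.Unary.Relation.Binary.Equality using (≐-setoid)

private
  variable
    a ℓ p : Level
    m n : ℕ

-- Parity and halving of natural numbers.

odd⇒1+j*2 : ∀ n → ¬ (2 ∣ n) → ∃[ j ] n ≡ suc (j *ℕ 2)
odd⇒1+j*2 n 2∤n = n / 2 , by-remainder (n % 2) (m%n<n n 2) (m≡m%n+[m/n]*n n 2)
  where
  by-remainder : ∀ r → r < 2 → n ≡ r +ℕ n / 2 *ℕ 2 → n ≡ suc (n / 2 *ℕ 2)
  by-remainder zero          _               eq = contradiction (divides (n / 2) eq) 2∤n
  by-remainder (suc zero)    _               eq = eq
  by-remainder (suc (suc _)) (s≤s (s≤s ())) _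

m+m≤n⇒m≤n/2 : m +ℕ m ≤ n → m ≤ n / 2
m+m≤n⇒m≤n/2 {m} {n} m+m≤n = ≡.subst (_≤ n / 2) m+m/2≡m (/-monoˡ-≤ 2 m+m≤n)
  where
  m+m/2≡m : (m +ℕ m) / 2 ≡ m
  m+m/2≡m = ≡.trans
    (≡.cong (_/ 2) (≡.trans (≡.cong (m +ℕ_) (≡.sym (ℕ.+-identityʳ m))) (ℕ.*-comm 2 m)))
    (m*n/n≡m m 2)

-- Counting up to setoid equality.

module _ (S : Setoid a ℓ) where

  open Setoid S

  -- The index of an element is whatever `cover` returns. Injectivity of `e` makes that choice
  -- independent of the membership proof and of the representative.
  enumeration⇒hasSize : {P : Pred Carrier p} (e : Fin n → Carrier) → (∀ i → P (e i)) →
    Injective _≡_ _≈_ e → (∀ {x} → P x → ∃[ i ] x ≈ e i) → HasSize S P n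
  enumeration⇒hasSize e e∈P e-injective cover = record
    { to        = λ (_ , x∈P) → proj₁ (cover x∈P)
    ; cong      = λ {(_ , x∈P)} {(_ , y∈P)} x≈y →
        e-injective (trans (sym (proj₂ (cover x∈P))) (trans x≈y (proj₂ (cover y∈P))))
    ; bijective =
        (λ {(_ , x∈P)} {(_ , y∈P)} eq →
          trans (proj₂ (cover x∈P))
            (trans (reflexive (≡.cong e eq)) (sym (proj₂ (cover y∈P)))))
      , λ i → (e i , e∈P i) , λ {(_ , z∈P)} z≈ei →
          e-injective (trans (sym (proj₂ (cover z∈P))) z≈ei)
    }

  -- Greedy selection from the end: an index is kept exactly when its value differs from all values
  -- already kept. The result enumerates the image of `f` without repetition.
  transversal : Decidable _≈_ → (f : Fin n → Carrier) →
    ∃[ m ] Σ[ s ∈ (Fin m → Fin n) ]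
      Injective _≡_ _≈_ (f ∘ s) × (∀ k → ∃[ i ] f k ≈ f (s i))
  transversal {zero}  _≟_ f = 0 , (λ ()) , (λ { {()} }) , λ ()
  transversal {suc n} _≟_ f with transversal _≟_ (f ∘ suc)
  ... | m , s , s-injective , cover with Fin.any? (λ i → f zero ≟ f (suc (s i)))
  ... | yes old = m , suc ∘ s , s-injective , λ { zero → old ; (suc k) → cover k }
  ... | no ¬old = suc m , s′ , s′-injective , cover′
    where
    s′ : Fin (suc m) → Fin (suc n)
    s′ zero    = zero
    s′ (suc i) = suc (s i)
    s′-injective : Injective _≡_ _≈_ (f ∘ s′)
    s′-injective {zero}  {zero}  _  = ≡.refl
    s′-injective {zero}  {suc j} eq = contradiction (j , eq) ¬old
    s′-injective {suc i} {zero}  eq = contradiction (i , sym eq) ¬old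
    s′-injective {suc i} {suc j} eq = ≡.cong suc (s-injective eq)
    cover′ : ∀ k → ∃[ i ] f k ≈ f (s′ i)
    cover′ zero    = zero , refl
    cover′ (suc k) = suc (proj₁ (cover k)) , proj₂ (cover k)

-- Counting the values of a function with a symmetry.

module _ {a′ ℓ′} {S : Setoid a ℓ} {T : Setoid a′ ℓ′} where

  private
    module S = Setoid S
    module T = Setoid T

  -- Send i to s i and also to σ (s i), or to an extra point if σ fixes s i.
  symmetric⇒2m≤1+n : Injection S (≡.setoid (Fin n)) →
    (f : S.Carrier → T.Carrier) → f Preserves S._≈_ ⟶ T._≈_ →
    (σ : S.Carrier → S.Carrier) → (∀ x → f (σ x) T.≈ f x) →
    (∀ {x y} → σ x S.≈ x → σ y S.≈ y → x S.≈ y) →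
    (s : Fin m → S.Carrier) → Injective _≡_ T._≈_ (f ∘ s) →
    m +ℕ m ≤ suc n
  symmetric⇒2m≤1+n {n} {m} index f f-cong σ f∘σ fixed-unique s f∘s-injective =
    Fin.injective⇒≤ (λ eq → Injection.injective split (g-injective _ _ eq))
    where
    open Injection index using (to; injective)

    split : Injection (≡.setoid (Fin (m +ℕ m))) (≡.setoid (Fin m ⊎ Fin m))
    split = Bijection.injection (Inverse⇒Bijection Fin.+↔⊎)

    fixed? : ∀ i → Dec (σ (s i) S.≈ s i)
    fixed? i = Fin.inj⇒≟ index (σ (s i)) (s i)

    g : Fin m ⊎ Fin m → Fin (suc n)
    g (inj₁ i) = suc (to (s i))
    g (inj₂ i) with fixed? i
    ... | yes _ = zero
    ... | no  _ = suc (to (σ (s i)))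

    s≈σs⇒≡ : ∀ {i j} → s i S.≈ σ (s j) → i ≡ j
    s≈σs⇒≡ eq = f∘s-injective (T.trans (f-cong eq) (f∘σ _))

    s≈σs⇒fixed : ∀ {i j} → s i S.≈ σ (s j) → σ (s j) S.≈ s j
    s≈σs⇒fixed eq = S.trans (S.sym eq) (S.reflexive (≡.cong s (s≈σs⇒≡ eq)))

    g-injective : ∀ u v → g u ≡ g v → u ≡ v
    g-injective (inj₁ i) (inj₁ j) eq =
      ≡.cong inj₁ (f∘s-injective (f-cong (injective (Fin.suc-injective eq))))
    -- A collision would make `s i` equal to `σ (s j)`. Invariance of `f` then forces `i ≡ j`, so
    -- `σ` would fix `s j`, and `g` sends such a `j` to the extra point `zero` instead.
    g-injective (inj₁ i) (inj₂ j) eq with fixed? j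
    ... | no ¬fixed =
      contradiction (s≈σs⇒fixed (injective (Fin.suc-injective eq))) ¬fixed
    g-injective (inj₂ i) (inj₁ j) eq with fixed? i
    ... | no ¬fixed =
      contradiction (s≈σs⇒fixed (S.sym (injective (Fin.suc-injective eq)))) ¬fixed
    g-injective (inj₂ i) (inj₂ j) eq with fixed? i | fixed? j
    ... | yes σi≈i | yes σj≈j =
      ≡.cong inj₂ (f∘s-injective (f-cong (fixed-unique σi≈i σj≈j)))
    ... | no _ | no _ = ≡.cong inj₂ (f∘s-injective
      (T.trans (T.sym (f∘σ _))
        (T.trans (f-cong (injective (Fin.suc-injective eq))) (f∘σ _))))

-- Bilinearity of the dot product and coordinate vectors.

module Geometry {c ℓ₁ ℓ₂} (F : HeytingField c ℓ₁ ℓ₂) where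

  open FieldGeometry F hiding (Carrier; _≈_; _+_; _*_; 0#; 1#; setoid)
  open CommutativeRing (commutativeRing F) hiding (zero)
  open SemiringSum semiring
  open RingProperties ring
  open SetoidReasoning setoid
  private module * = CommutativeSemigroupProperties *-commutativeSemigroup

  ·-cong : ∀ {d} {x x′ y y′ : Vector𝔽 d} → x ≋ x′ → y ≋ y′ → x · y ≈ x′ · y′
  ·-cong x≋x′ y≋y′ = sum-cong-≋ λ i → *-cong (x≋x′ i) (y≋y′ i)

  ·-comm : ∀ {d} (x y : Vector𝔽 d) → x · y ≈ y · x
  ·-comm x y = sum-cong-≋ λ i → *-comm (x i) (y i)

  ·-+ᵛ : ∀ {d} (x y z : Vector𝔽 d) → x · (y +ᵛ z) ≈ x · y + x · z
  ·-+ᵛ x y z = trans (sum-cong-≋ λ i → distribˡ (x i) (y i) (z i))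
    (∑-distrib-+ (zipWith _*_ x y) (zipWith _*_ x z))

  ·-*ᵛ : ∀ {d} (x : Vector𝔽 d) a y → x · (a *ᵛ y) ≈ a * x · y
  ·-*ᵛ x a y = trans (sum-cong-≋ λ i → *.x∙yz≈y∙xz (x i) a (y i))
    (sym (*-distribˡ-sum a (zipWith _*_ x y)))

  basis : ∀ {d} → Fin d → Vector𝔽 d
  basis zero    = 1# ∷ 0ᵛ
  basis (suc i) = 0# ∷ basis i

  ·-0ᵛ : ∀ {d} (x : Vector𝔽 d) → x · 0ᵛ ≈ 0#
  ·-0ᵛ {d} x = trans (sum-cong-≋ λ i → zeroʳ (x i)) (sum-replicate-zero d)

  ·-basis : ∀ {d} (x : Vector𝔽 d) i → x · basis i ≈ x i
  ·-basis x zero    = trans (+-cong (*-identityʳ _) (·-0ᵛ (x ∘ suc))) (+-identityʳ _)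
  ·-basis x (suc i) = trans (+-cong (zeroʳ _) (·-basis (x ∘ suc) i)) (+-identityˡ _)

  basis-diagonal : ∀ {d} (i : Fin d) → basis i i ≈ 1#
  basis-diagonal zero    = refl
  basis-diagonal (suc i) = basis-diagonal i

  -- Cosets of `V ⊥` for a line `V` through a unit vector.

  module _ {d} {V : Subset d} (line : IsLine V) {y} (y∈V : y ∈ V) (∥y∥≈1 : y ∈ Sphere) where

    open IsLine line

    -- Writing y ≋ a *ᵛ v, the equation 1 ≈ y · y ≈ a * y · v shows that a is invertible.
    ·≈0⇒∈⊥ : ∀ w → y · w ≈ 0# → w ∈ V ⊥
    ·≈0⇒∈⊥ w y·w≈0 u u∈V with spans y∈V | spans u∈V
    ... | a , y≋av | b , u≋bv = begin
      w · u                ≈⟨ ·-cong (λ _ → refl) u≋bv ⟩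
      w · (b *ᵛ direction) ≈⟨ ·-*ᵛ w b direction ⟩
      b * w · direction    ≈⟨ *-congˡ w·v≈0 ⟩
      b * 0#               ≈⟨ zeroʳ b ⟩
      0#                   ∎
      where
      ·y : ∀ x → x · y ≈ a * x · direction
      ·y x = trans (·-cong (λ _ → refl) y≋av) (·-*ᵛ x a direction)
      w·v≈0 : w · direction ≈ 0#
      w·v≈0 = begin
        w · direction                         ≈⟨ *-identityˡ _ ⟨
        1# * w · direction                    ≈⟨ *-congʳ ∥y∥≈1 ⟨
        (y · y) * w · direction               ≈⟨ *-congʳ (·y y) ⟩
        (a * y · direction) * w · direction   ≈⟨ *.xy∙z≈y∙xz a _ _ ⟩
        y · direction * (a * w · direction)   ≈⟨ *-congˡ (·y w) ⟨
        y · direction * w · y                 ≈⟨ *-congˡ (trans (·-comm w y) y·w≈0) ⟩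
        y · direction * 0#                    ≈⟨ zeroʳ _ ⟩
        0#                                    ∎

    ∈Coset⇒·≈ : ∀ {x z} → z ∈ Coset x (V ⊥) → y · z ≈ y · x
    ∈Coset⇒·≈ {x} {z} (w , w∈V⊥ , z≋x+w) = begin
      y · z          ≈⟨ ·-cong (λ _ → refl) z≋x+w ⟩
      y · (x +ᵛ w)   ≈⟨ ·-+ᵛ y x w ⟩
      y · x + y · w  ≈⟨ +-congˡ (trans (·-comm y w) (w∈V⊥ y y∈V)) ⟩
      y · x + 0#     ≈⟨ +-identityʳ _ ⟩
      y · x          ∎

    ·≈⇒∈Coset : ∀ {x z} → y · z ≈ y · x → z ∈ Coset x (V ⊥)
    ·≈⇒∈Coset {x} {z} y·z≈y·x = w , ·≈0⇒∈⊥ w y·w≈0 , z≋x+w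
      where
      w : Vector𝔽 d
      -- The difference of `z` and `x`, spelled with `*ᵛ` and `+ᵛ` so that `·-*ᵛ` and `·-+ᵛ` apply.
      w = (- 1#) *ᵛ x +ᵛ z
      y·w≈0 : y · w ≈ 0#
      y·w≈0 = begin
        y · w                         ≈⟨ ·-+ᵛ y _ z ⟩
        y · ((- 1#) *ᵛ x) + y · z     ≈⟨ +-cong (·-*ᵛ y (- 1#) x) y·z≈y·x ⟩
        - 1# * y · x + y · x          ≈⟨ +-congʳ (-1*x≈-x _) ⟩
        - (y · x) + y · x             ≈⟨ -‿inverseˡ _ ⟩
        0#                            ∎
      z≋x+w : z ≋ x +ᵛ w
      z≋x+w i = begin
        z i                       ≈⟨ +-identityˡ _ ⟨
        0# + z i                  ≈⟨ +-congʳ (-‿inverseʳ (x i)) ⟨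
        x i - x i + z i           ≈⟨ +-congʳ (+-congˡ (-1*x≈-x (x i))) ⟨
        x i + - 1# * x i + z i    ≈⟨ +-assoc _ _ _ ⟩
        x i + (- 1# * x i + z i)  ∎

    Coset-cong : ∀ {x z} → y · x ≈ y · z → Coset x (V ⊥) ≐ Coset z (V ⊥)
    Coset-cong eq =
      (λ u∈ → ·≈⇒∈Coset (trans (∈Coset⇒·≈ u∈) eq)) ,
      (λ u∈ → ·≈⇒∈Coset (trans (∈Coset⇒·≈ u∈) (sym eq)))

    Coset-injective : ∀ {x z} → Coset x (V ⊥) ≐ Coset z (V ⊥) → y · x ≈ y · z
    Coset-injective (Cx⊆Cz , _) = ∈Coset⇒·≈ (Cx⊆Cz (·≈⇒∈Coset refl))

    -- By `Coset-cong` and `Coset-injective`, a coset is determined by its value under `y ·_`, and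
    -- distinct values give distinct cosets. An enumeration of the values therefore becomes one of
    -- the cosets, each represented by the point of `E` witnessing its value.
    projection-hasSize : ∀ {E} → HasSize setoid (DotValues y E) n →
      HasSize (≐-setoid (Vector𝔽 d) (c ⊔ ℓ₁)) (Projection V E) n
    projection-hasSize {E = E} size = enumeration⇒hasSize P-setoid
      (λ i → Coset (point i) (V ⊥))
      (λ i → point i , (≐.refl {Coset (point i) (V ⊥)}) , point i , ·≈⇒∈Coset refl , point∈E i)
      (λ {i} {j} eq → ≡.trans (≡.sym (strictlyInverseˡ i))
        (≡.trans (to-cong (value-injective i j (Coset-injective eq))) (strictlyInverseˡ j)))
      cover
      where
      P-setoid = ≐-setoid (Vector𝔽 d) (c ⊔ ℓ₁)
      module ≐ = Setoid P-setoid
      open Inverse (Bijection⇒Inverse size) using (to; from; to-cong; strictlyInverseˡ; strictlyInverseʳ)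
      point : Fin _ → Vector𝔽 d
      point i = proj₁ (proj₂ (from i))
      point∈E : ∀ i → point i ∈ E
      point∈E i = proj₁ (proj₂ (proj₂ (from i)))
      value≈ : ∀ i → proj₁ (from i) ≈ y · point i
      value≈ i = proj₂ (proj₂ (proj₂ (from i)))
      value-injective : ∀ i j → y · point i ≈ y · point j → proj₁ (from i) ≈ proj₁ (from j)
      value-injective i j eq = trans (value≈ i) (trans eq (sym (value≈ j)))
      cover : ∀ {C} → C ∈ Projection V E → ∃[ i ] C ≐ Coset (point i) (V ⊥)
      -- The value is read off at `z`, since the representative `x` itself may lie outside `E`.
      cover {C} (x , C≐Cx , z , z∈Cx , z∈E) = to v ,
        ≐.trans {C} {Coset x (V ⊥)} {Coset (point (to v)) (V ⊥)} C≐Cx (Coset-cong (begin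
          y · x               ≈⟨ ∈Coset⇒·≈ z∈Cx ⟨
          y · z               ≈⟨ strictlyInverseʳ v ⟨
          proj₁ (from (to v)) ≈⟨ value≈ (to v) ⟩
          y · point (to v)    ∎))
        where
        v : ∃[ b ] DotValues y E b
        v = y · z , z , z∈E , refl

  -- One inclusion is built into `𝒯₁`. For the other, each line in `X-π λ₀` carries a unit vector
  -- with last coordinate `λ₀`, and taking it as `y` turns the bound on dot values into a bound on
  -- cosets.
  𝒯₁≐X-π : ∀ {n} {λ₀} {E : Subset (suc n)} {N} →
    (∀ y → y ∈ Hyperplane λ₀ → SizeAtMost setoid (DotValues y E) N) →
    𝒯₁ (X-π λ₀) E N ≐ X-π λ₀
  𝒯₁≐X-π {λ₀ = λ₀} {E} {N} bound = proj₁ , λ V∈X → V∈X , projection-bound V∈X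
    where
    projection-bound : ∀ {V} → V ∈ X-π λ₀ →
      SizeAtMost (≐-setoid _ (c ⊔ ℓ₁)) (Projection V E) N
    projection-bound (line , y , y∈V , _ , y∈π , ∥y∥≈1) =
      let m , m≤N , size = bound y y∈π
      in m , m≤N , projection-hasSize line y∈V ∥y∥≈1 size

  range-respects : ∀ {d} {curve : Carrier → Vector𝔽 d} →
    (λ x → ∃[ t ] x ≋ curve t) Respects _≋_
  range-respects x≋y (t , x≋) = t , λ i → trans (sym (x≋y i)) (x≋ i)

-- Inverses and characteristic in a finite field.

module FiniteField {c ℓ₁ ℓ₂} (F : HeytingField c ℓ₁ ℓ₂) {q : ℕ} (order : HasOrder F q) where

  open Geometry F
  open FieldGeometry F hiding (Carrier; _≈_; _+_; _*_; 0#; 1#; setoid)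
  open HeytingField F using (#⇒invertible; tight; heytingCommutativeRing)
  open HeytingProperties heytingCommutativeRing using (1#0; x-0≈x)
  open CommutativeRing (commutativeRing F) hiding (zero)
  open SemiringSum semiring
  open SemiringMult semiring using (×1-homo-*) renaming (_×_ to _×#_)
  open RingProperties ring
  open SetoidReasoning setoid
  private
    module + = CommutativeSemigroupProperties +-commutativeSemigroup
    module * = CommutativeSemigroupProperties *-commutativeSemigroup
  open Inverse (Bijection⇒Inverse order) using (strictlyInverseˡ; strictlyInverseʳ)
    renaming (to to index; from to element; to-cong to index-cong)

  _≟_ : Decidable _≈_
  _≟_ = Fin.inj⇒≟ (Bijection.injection order)

  -- Invertibility is decidable by search, and tightness makes it irrefutable.
  ≉0⇒leftInverse : ∀ {x} → ¬ x ≈ 0# → ∃[ y ] y * x ≈ 1#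
  ≉0⇒leftInverse {x} x≉0 with Fin.any? (λ i → (element i * x) ≟ 1#)
  ... | yes (i , eq) = element i , eq
  ... | no ¬inverse  = contradiction (proj₁ (tight x 0#) λ x#0 →
      let y , y[x-0]≈1 , _ = #⇒invertible x#0
      in ¬inverse (index y , (begin
        element (index y) * x  ≈⟨ *-cong (strictlyInverseʳ y) (sym (x-0≈x x)) ⟩
        y * (x - 0#)           ≈⟨ y[x-0]≈1 ⟩
        1#                     ∎))) x≉0

  -- Translation by x permutes the field, so it does not change the sum of all elements.
  q×x≈0 : ∀ x → q ×# x ≈ 0#
  q×x≈0 x = +-cancelˡ (sum element) _ _ (begin
    sum element + q ×# x                   ≈⟨ +-congˡ (sum-replicate q) ⟨
    sum element + sum (replicate q x)      ≈⟨ ∑-distrib-+ element (replicate q x) ⟨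
    sum (λ i → element i + x)              ≈⟨ sum-cong-≋ (λ i → strictlyInverseʳ (element i + x)) ⟨
    sum (λ i → element (π ⟨$⟩ʳ i))         ≈⟨ sum-permute element π ⟨
    sum element                            ≈⟨ +-identityʳ _ ⟨
    sum element + 0#                       ∎)
    where
    translate : Carrier → Fin q → Fin q
    translate y i = index (element i + y)
    -- Stated for any two opposite elements, so that it yields both inverse laws of `π`.
    translate-inverse : ∀ {y z} → y + z ≈ 0# → ∀ i → translate z (translate y i) ≡ i
    translate-inverse {y} {z} y+z≈0 i = ≡.trans (index-cong (begin
      element (index (element i + y)) + z  ≈⟨ +-congʳ (strictlyInverseʳ _) ⟩
      element i + y + z                    ≈⟨ +-assoc _ _ _ ⟩
      element i + (y + z)                  ≈⟨ +-congˡ y+z≈0 ⟩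
      element i + 0#                       ≈⟨ +-identityʳ _ ⟩
      element i                            ∎)) (strictlyInverseˡ i)
    π : Permutation q q
    π = permutation (translate x) (translate (- x))
      (translate-inverse (-‿inverseˡ x)) (translate-inverse (-‿inverseʳ x))

  -- Write `q` as 1 + 2j. If 1 + 1 vanished, then `q ×# 1#` would reduce to `1#`; but it is zero by
  -- `q×x≈0`, and `1#` is apart from `0#`.
  odd⇒1+1≉0 : ¬ (2 ∣ q) → ¬ (1# + 1# ≈ 0#)
  odd⇒1+1≉0 2∤q 1+1≈0 with odd⇒1+j*2 q 2∤q
  ... | j , ≡.refl = proj₂ (tight 1# 0#) 1≈0 1#0
    where
    1≈0 : 1# ≈ 0#
    1≈0 = begin
      1#                             ≈⟨ +-identityʳ 1# ⟨
      1# + 0#                        ≈⟨ +-congˡ (zeroʳ (j ×# 1#)) ⟨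
      1# + (j ×# 1#) * 0#            ≈⟨ +-congˡ (*-congˡ (trans (+-congˡ (+-identityʳ 1#)) 1+1≈0)) ⟨
      -- After the match, `q` is `suc (j *ℕ 2)`, so `q ×# 1#` unfolds to `1# + (j *ℕ 2) ×# 1#`.
      1# + (j ×# 1#) * (2 ×# 1#)     ≈⟨ +-congˡ (×1-homo-* j 2) ⟨
      q ×# 1#                        ≈⟨ q×x≈0 1# ⟩
      0#                             ∎

  -- Dot values along a parametrized curve.

  module _ {d} {curve : Carrier → Vector𝔽 d} (curve-cong : curve Preserves _≈_ ⟶ _≋_) where

    range-hasSize : Injective _≈_ _≋_ curve →
      HasSize (≋-setoid d) (λ x → ∃[ t ] x ≋ curve t) q
    range-hasSize curve-injective = enumeration⇒hasSize (≋-setoid d)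
      (curve ∘ element)
      (λ i → element i , λ _ → refl)
      (λ {i} {j} eq → ≡.trans (≡.sym (strictlyInverseˡ i))
        (≡.trans (index-cong (curve-injective eq)) (strictlyInverseˡ j)))
      λ (t , x≋) → index t , λ k → trans (x≋ k) (sym (curve-cong (strictlyInverseʳ t) k))

    -- `transversal` picks one parameter per value, and `symmetric⇒2m≤1+n` bounds their number
    -- because `t ↦ b - t` fixes at most b/2. The curve is left arbitrary so that the axis and the
    -- parabola share the argument.
    dotValues-bound : ¬ (1# + 1# ≈ 0#) → ∀ y b →
      (∀ t → y · curve (b - t) ≈ y · curve t) →
      SizeAtMost setoid (DotValues y (λ x → ∃[ t ] x ≋ curve t)) ((q +ℕ 1) / 2)
    dotValues-bound 1+1≉0 y b f∘σ with transversal setoid _≟_ (λ i → y · curve (element i))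
    ... | m , s , s-injective , cover = m , m≤[q+1]/2 , enumeration⇒hasSize setoid
      (f ∘ element ∘ s)
      (λ i → curve (element (s i)) , (element (s i) , λ _ → refl) , refl)
      s-injective
      λ (x , (t , x≋) , v≈y·x) → proj₁ (cover (index t)) ,
        trans v≈y·x (trans (·-cong (λ _ → refl) x≋)
          (trans (f-cong (sym (strictlyInverseʳ t))) (proj₂ (cover (index t)))))
      where
      f : Carrier → Carrier
      f t = y · curve t

      f-cong : f Preserves _≈_ ⟶ _≈_
      f-cong t≈u = ·-cong (λ _ → refl) (curve-cong t≈u)

      half : Carrier
      half = proj₁ (≉0⇒leftInverse 1+1≉0)

      fixed≈b/2 : ∀ {t} → b - t ≈ t → t ≈ half * b
      fixed≈b/2 {t} b-t≈t = begin
        t                         ≈⟨ *-identityˡ t ⟨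
        1# * t                    ≈⟨ *-congʳ (proj₂ (≉0⇒leftInverse 1+1≉0)) ⟨
        half * (1# + 1#) * t      ≈⟨ *-assoc _ _ _ ⟩
        half * ((1# + 1#) * t)    ≈⟨ *-congˡ (distribʳ t 1# 1#) ⟩
        half * (1# * t + 1# * t)  ≈⟨ *-congˡ (+-cong (*-identityˡ t) (*-identityˡ t)) ⟩
        half * (t + t)            ≈⟨ *-congˡ (+-congʳ b-t≈t) ⟨
        half * (b - t + t)        ≈⟨ *-congˡ (+-assoc b (- t) t) ⟩
        half * (b + (- t + t))    ≈⟨ *-congˡ (+-congˡ (-‿inverseˡ t)) ⟩
        half * (b + 0#)           ≈⟨ *-congˡ (+-identityʳ b) ⟩
        half * b                  ∎

      m≤[q+1]/2 : m ≤ (q +ℕ 1) / 2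
      -- The 1 added to `q` is the extra point reserved for the fixed parameter.
      m≤[q+1]/2 = m+m≤n⇒m≤n/2 (≡.subst (m +ℕ m ≤_) (ℕ.+-comm 1 q)
        (symmetric⇒2m≤1+n {T = setoid} (Bijection.injection order) f f-cong (λ t → b - t) f∘σ
          (λ σt≈t σu≈u → trans (fixed≈b/2 σt≈t) (sym (fixed≈b/2 σu≈u)))
          (element ∘ s) s-injective))

  -- The axis, the parabola and the reflection of a quadratic.

  axis : ∀ {n} → Carrier → Vector𝔽 (suc n)
  axis {n} t = t *ᵛ basis (fromℕ n)

  axis-cong : ∀ {n} → axis {n} Preserves _≈_ ⟶ _≋_
  axis-cong t≈u _ = *-congʳ t≈u

  axis-injective : ∀ {n} → Injective _≈_ _≋_ (axis {n})
  axis-injective {n} {t} {u} eq = trans (sym (last-axis t)) (trans (eq (fromℕ n)) (last-axis u))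
    where
    last-axis : ∀ t → axis t (fromℕ n) ≈ t
    last-axis t = trans (*-congˡ (basis-diagonal (fromℕ n))) (*-identityʳ t)

  ·-axis : ∀ {n} (y : Vector𝔽 (suc n)) t → y · axis t ≈ t * y (fromℕ n)
  ·-axis {n} y t = trans (·-*ᵛ y t (basis (fromℕ n))) (*-congˡ (·-basis y (fromℕ n)))

  -- Having at least two coordinates keeps the first apart from the last, so the parameter can be
  -- read off at `zero`.
  parabola : ∀ {n} → Carrier → Vector𝔽 (suc (suc n))
  parabola t = t *ᵛ basis zero +ᵛ axis (t * t)

  parabola-cong : ∀ {n} → parabola {n} Preserves _≈_ ⟶ _≋_
  parabola-cong t≈u i = +-cong (*-congʳ t≈u) (axis-cong (*-cong t≈u t≈u) i)

  parabola-injective : ∀ {n} → Injective _≈_ _≋_ (parabola {n})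
  parabola-injective {n} {t} {u} eq = trans (sym (head-parabola t)) (trans (eq zero) (head-parabola u))
    where
    head-parabola : ∀ t → parabola {n} t zero ≈ t
    head-parabola t = trans (+-cong (*-identityʳ t) (zeroʳ _)) (+-identityʳ t)

  -- The quadratic is kept factored because `quadratic-reflect` works on its two factors.
  ·-parabola : ∀ {n} (y : Vector𝔽 (suc (suc n))) t →
    y · parabola t ≈ t * (y zero + t * y (fromℕ (suc n)))
  ·-parabola {n} y t = begin
    y · parabola t                                      ≈⟨ ·-+ᵛ y (t *ᵛ basis zero) (axis (t * t)) ⟩
    y · (t *ᵛ basis zero) + y · axis (t * t)            ≈⟨ +-cong (·-*ᵛ y t (basis zero)) (·-axis y (t * t)) ⟩
    t * y · basis zero + t * t * y (fromℕ (suc n))      ≈⟨ +-cong (*-congˡ (·-basis y zero)) (*-assoc t t _) ⟩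
    t * y zero + t * (t * y (fromℕ (suc n)))            ≈⟨ distribˡ t _ _ ⟨
    t * (y zero + t * y (fromℕ (suc n)))                ∎

  module _ {b e l} (b*l≈-e : b * l ≈ - e) where

    reflect-factor : ∀ t → e + (b - t) * l ≈ - (t * l)
    reflect-factor t = begin
      e + (b - t) * l          ≈⟨ +-congˡ (distribʳ l b (- t)) ⟩
      e + (b * l + - t * l)    ≈⟨ +-assoc _ _ _ ⟨
      e + b * l + - t * l      ≈⟨ +-cong (+-congˡ b*l≈-e) (sym (-‿distribˡ-* t l)) ⟩
      e - e + - (t * l)        ≈⟨ +-congʳ (-‿inverseʳ e) ⟩
      0# + - (t * l)           ≈⟨ +-identityˡ _ ⟩
      - (t * l)                ∎

    -- As `b * l` is `- e`, the factor e + s l equals -(b - s) l, both for s = t and for s = b - t.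
    -- Each side is thus -t (b - t) l.
    quadratic-reflect : ∀ t → (b - t) * (e + (b - t) * l) ≈ t * (e + t * l)
    quadratic-reflect t = begin
      (b - t) * (e + (b - t) * l)   ≈⟨ *-congˡ (reflect-factor t) ⟩
      (b - t) * - (t * l)           ≈⟨ -‿distribʳ-* (b - t) (t * l) ⟨
      - ((b - t) * (t * l))         ≈⟨ -‿cong (*.x∙yz≈y∙xz (b - t) t l) ⟩
      - (t * ((b - t) * l))         ≈⟨ -‿distribʳ-* t _ ⟩
      t * - ((b - t) * l)           ≈⟨ *-congˡ (+-inverseˡ-unique _ _ sum≈0) ⟨
      t * (e + t * l)               ∎
      where
      sum≈0 : e + t * l + (b - t) * l ≈ 0#
      sum≈0 = begin
        e + t * l + (b - t) * l    ≈⟨ +.xy∙z≈xz∙y e _ _ ⟩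
        e + (b - t) * l + t * l    ≈⟨ +-congʳ (reflect-factor t) ⟩
        - (t * l) + t * l          ≈⟨ -‿inverseˡ _ ⟩
        0#                         ∎

-- Choice of the set according to whether `λ₀` vanishes.

mainTheorem6 : ∀ {c ℓ₁ ℓ₂} (F : HeytingField c ℓ₁ ℓ₂) (q : ℕ) → IsOddPrimePower q → HasOrder F q →
    let open FieldGeometry F in
    (n : ℕ) → 3 ≤ suc n → (λ₀ : Carrier) →
    Σ[ E ∈ Subset (suc n) ]
    (E Respects _≋_)
    × HasSize (≋-setoid (suc n)) E q
    × (∀ (y : Vector𝔽 (suc n)) → y ∈ Hyperplane λ₀ →
    SizeAtMost setoid (DotValues y E) ((q +ℕ 1) / 2))
    × (𝒯₁ (X-π λ₀) E ((q +ℕ 1) / 2) ≐ X-π λ₀)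
mainTheorem6 F q _ order zero (s≤s ()) λ₀
mainTheorem6 F q (_ , _ , _ , _ , _ , 2∤q) order (suc n) _ λ₀ with FiniteField._≟_ F order λ₀ 0#
  where open CommutativeRing (commutativeRing F)
... | yes λ₀≈0 = _ , range-respects , range-hasSize axis-cong axis-injective , bound , 𝒯₁≐X-π bound
  where
  open FiniteField F order
  open Geometry F
  open FieldGeometry F
  open CommutativeRing (commutativeRing F) using (trans; sym; *-congˡ; zeroʳ; _-_)
  ·-axis≈0 : ∀ (y : Vector𝔽 (suc (suc n))) → y ∈ Hyperplane λ₀ → ∀ t → y · axis t ≈ 0#
  ·-axis≈0 y y∈π t = trans (·-axis y t) (trans (*-congˡ (trans y∈π λ₀≈0)) (zeroʳ t))
  bound : ∀ y → y ∈ Hyperplane λ₀ → SizeAtMost setoid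
    (DotValues y (λ x → ∃[ t ] x ≋ axis t)) ((q +ℕ 1) / 2)
  -- All dot values on the axis are zero, so every reflection preserves them; `0#` is an arbitrary
  -- choice of `b`.
  bound y y∈π = dotValues-bound axis-cong (odd⇒1+1≉0 2∤q) y 0#
    (λ t → trans (·-axis≈0 y y∈π (0# - t)) (sym (·-axis≈0 y y∈π t)))
... | no λ₀≉0 = _ , range-respects , range-hasSize parabola-cong parabola-injective , bound , 𝒯₁≐X-π bound
  where
  open FiniteField F order
  open Geometry F
  open FieldGeometry F
  open CommutativeRing (commutativeRing F)
    using (trans; sym; *-congˡ; *-identityʳ; *-assoc; _-_; -_)
  bound : ∀ y → y ∈ Hyperplane λ₀ → SizeAtMost setoid
    (DotValues y (λ x → ∃[ t ] x ≋ parabola t)) ((q +ℕ 1) / 2)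
  bound y y∈π = dotValues-bound parabola-cong (odd⇒1+1≉0 2∤q) y b
    (λ t → trans (·-parabola y (b - t)) (trans (quadratic-reflect b*λ₀≈-e t) (sym (·-parabola y t))))
    where
    -- The sum of the roots 0 and -y₁/λ₀ of the quadratic y₁ t + λ₀ t², hence the constant for which
    -- `t ↦ b - t` preserves it.
    b = - y zero * proj₁ (≉0⇒leftInverse λ₀≉0)
    b*λ₀≈-e : b * y (fromℕ (suc n)) ≈ - y zero
    b*λ₀≈-e = trans (*-assoc _ _ _)
      (trans (*-congˡ (trans (*-congˡ y∈π) (proj₂ (≉0⇒leftInverse λ₀≉0)))) (*-identityʳ _))
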